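{- In the preemptive FIFO buffer management problem, let $B$ be a buffer state and $\sigma$ an input sequence. Let $\mathrm{OPT}_{\emptyset}(\sigma)$ and $\mathrm{OPT}_B(\sigma)$ denote the optimal schedules constructed strictly from packets arriving in the future input sequence $\sigma$, starting from buffer states $\emptyset$ and $B$, respectively (i.e. the packets of $\sigma$ transmitted by the optimal schedule on $\sigma$ started from $\emptyset$, respectively from $B$). Then $$v(\mathrm{OPT}_{\emptyset}(\sigma))\ \ge\ v(\mathrm{OPT}_B(\sigma)).$$
   Context: Preemptive FIFO buffer management. A buffer has fixed finite capacity. Time is discrete, $i\in\{1,\dots,T\}$. An input is $\sigma=(\sigma_1,\dots,\sigma_T)$, where $\sigma_i=(p_{i_1},\dots,p_{i_k})$, $k\in\mathbb{Z}_+$, is the sequence of packets arriving at step $i$; each packet $p$ has a nonnegative real value $v(p)$. Each step has two phases. Arrival phase: for each arriving packet in turn, the algorithm immediately accepts or drops it, and it may preempt (permanently discard) any packets in the buffer; an accepted packet is placed at the tail of the buffer, and the capacity may never be exceeded. Transmission phase: after all arrivals of the step, the packet at the head of the buffer (if any) is transmitted and its value is gained. A buffer state $B$ is a FIFO-ordered list of packets respecting the capacity. Starting from $B$ means that before step 1 the buffer contains $B$; its packets may be transmitted or preempted like any others. $\mathrm{OPT}(B,\sigma)$ is an offline optimal schedule (maximum total transmitted value, counting packets of both $B$ and $\sigma$) on $\sigma$ starting from $B$. $\mathrm{OPT}_B(\sigma)$ is the part of $\mathrm{OPT}(B,\sigma)$ consisting of transmitted packets that arrive in $\sigma$ (as opposed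 to those originally in $B$). The value $v(\cdot)$ of a schedule is the sum of the values of its packets. -}

module Defs where

open import Algebra.Properties.CommutativeSemigroup using (interchange)
open import Data.Bool using (Bool; true; false)
open import Data.List using (List; []; _∷_; _∷ʳ_; _++_; map; length; take; drop; foldr; filterᵇ)
open import Data.List.Relation.Binary.Sublist.Propositional using (_⊆_)
open import Data.Nat as ℕ using (ℕ)
import Data.Nat.Properties as ℕ
open import Data.Product using (∃; _×_; _,_; proj₁; proj₂)
open import Data.Rational as ℚ using (ℚ; 0ℚ; ½; ∣_∣)
import Data.Rational.Properties as ℚ
open import Relation.Binary.PropositionalEquality using (_≡_; sym; trans; cong; subst; module ≡-Reasoning)

-- Real numbers as Cauchy sequences of rationals.  No quotient is taken:
-- x and y denote the same real when x ≤ℝ y and y ≤ℝ x.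

IsCauchy : (ℕ → ℚ) → Set
IsCauchy x = ∀ ε → 0ℚ ℚ.< ε → ∃ λ N → ∀ m n → N ℕ.≤ m → N ℕ.≤ n → ∣ x m ℚ.- x n ∣ ℚ.< ε

record ℝ : Set where
  constructor mkℝ
  field
    seq    : ℕ → ℚ
    cauchy : IsCauchy seq

open ℝ public

infix 4 _≤ℝ_
infixl 6 _+ℝ_

_≤ℝ_ : ℝ → ℝ → Set
x ≤ℝ y = ∀ ε → 0ℚ ℚ.< ε → ∃ λ N → ∀ n → N ℕ.≤ n → seq x n ℚ.≤ seq y n ℚ.+ ε

0ℝ : ℝ
0ℝ = mkℝ (λ _ → 0ℚ) (λ ε 0<ε → 0 , λ _ _ _ _ → 0<ε)

private
  half-pos : ∀ ε → 0ℚ ℚ.< ε → 0ℚ ℚ.< ½ ℚ.* ε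
  half-pos ε 0<ε = subst (ℚ._< ½ ℚ.* ε) (ℚ.*-zeroʳ ½) (ℚ.*-monoʳ-<-pos ½ 0<ε)

  half+half : ∀ ε → ½ ℚ.* ε ℚ.+ ½ ℚ.* ε ≡ ε
  half+half ε = trans (sym (ℚ.*-distribʳ-+ ε ½ ½)) (ℚ.*-identityˡ ε)

  sub-interchange : ∀ a b c d → (a ℚ.+ b) ℚ.- (c ℚ.+ d) ≡ (a ℚ.- c) ℚ.+ (b ℚ.- d)
  sub-interchange a b c d = begin
    (a ℚ.+ b) ℚ.- (c ℚ.+ d)            ≡⟨ cong ((a ℚ.+ b) ℚ.+_) (ℚ.neg-distrib-+ c d) ⟩
    (a ℚ.+ b) ℚ.+ (ℚ.- c ℚ.+ ℚ.- d)    ≡⟨ interchange ℚ+ a b (ℚ.- c) (ℚ.- d) ⟩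
    (a ℚ.- c) ℚ.+ (b ℚ.- d)            ∎
    where
      open ≡-Reasoning
      open import Algebra.Bundles using (CommutativeMonoid)
      ℚ+ = CommutativeMonoid.commutativeSemigroup ℚ.+-0-commutativeMonoid

  +-isCauchy : ∀ {x y} → IsCauchy x → IsCauchy y → IsCauchy (λ n → x n ℚ.+ y n)
  +-isCauchy {x} {y} cx cy ε 0<ε = Nx ℕ.⊔ Ny , close
    where
      Nx = proj₁ (cx (½ ℚ.* ε) (half-pos ε 0<ε))
      Ny = proj₁ (cy (½ ℚ.* ε) (half-pos ε 0<ε))

      close : ∀ m n → Nx ℕ.⊔ Ny ℕ.≤ m → Nx ℕ.⊔ Ny ℕ.≤ n →
              ∣ (x m ℚ.+ y m) ℚ.- (x n ℚ.+ y n) ∣ ℚ.< ε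
      close m n N≤m N≤n = begin-strict
        ∣ (x m ℚ.+ y m) ℚ.- (x n ℚ.+ y n) ∣    ≡⟨ cong ∣_∣ (sub-interchange (x m) (y m) (x n) (y n)) ⟩
        ∣ (x m ℚ.- x n) ℚ.+ (y m ℚ.- y n) ∣    ≤⟨ ℚ.∣p+q∣≤∣p∣+∣q∣ (x m ℚ.- x n) (y m ℚ.- y n) ⟩
        ∣ x m ℚ.- x n ∣ ℚ.+ ∣ y m ℚ.- y n ∣    <⟨ ℚ.+-mono-< closeˣ closeʸ ⟩
        ½ ℚ.* ε ℚ.+ ½ ℚ.* ε                    ≡⟨ half+half ε ⟩
        ε                                      ∎
        where
          open ℚ.≤-Reasoning
          closeˣ = proj₂ (cx (½ ℚ.* ε) (half-pos ε 0<ε)) m n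
                     (ℕ.m⊔n≤o⇒m≤o Nx Ny N≤m) (ℕ.m⊔n≤o⇒m≤o Nx Ny N≤n)
          closeʸ = proj₂ (cy (½ ℚ.* ε) (half-pos ε 0<ε)) m n
                     (ℕ.m⊔n≤o⇒n≤o Nx Ny N≤m) (ℕ.m⊔n≤o⇒n≤o Nx Ny N≤n)

_+ℝ_ : ℝ → ℝ → ℝ
x +ℝ y = mkℝ (λ n → seq x n ℚ.+ seq y n) (+-isCauchy {seq x} {seq y} (cauchy x) (cauchy y))

record Packet : Set where
  constructor mkPacket
  field
    value  : ℝ
    nonneg : 0ℝ ≤ℝ value

open Packet public

-- One list of arriving packets per time step; T is the length of the outer list.
Input : Set
Input = List (List Packet)

record BufferState (capacity : ℕ) : Set where
  constructor mkBufferState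
  field
    packets : List Packet
    fits    : length packets ℕ.≤ capacity

open BufferState public

∅ : ∀ {capacity} → BufferState capacity
∅ = mkBufferState [] ℕ.z≤n

-- During a run every packet carries its origin, so that packets of the initial
-- buffer stay distinguishable from equal-valued packets of the input.
data Origin : Set where
  fromBuffer fromInput : Origin

Tagged : Set
Tagged = Origin × Packet

arrivesInInput : Tagged → Bool
arrivesInInput (fromBuffer , _) = false
arrivesInInput (fromInput  , _) = true

-- Arrivals c ps b b′: a possible course of an arrival phase in which ps arrives
-- and which takes the buffer contents from b to b′ (head of the list = head of
-- the buffer).  Preemption may happen at any moment of the phase, any number of times.
data Arrivals (capacity : ℕ) : List Packet → List Tagged → List Tagged → Set where
  done    : ∀ {b} → Arrivals capacity [] b b
  preempt : ∀ {ps b b′ b″} → b′ ⊆ b →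
            Arrivals capacity ps b′ b″ → Arrivals capacity ps b b″
  reject  : ∀ {p ps b b″} →
            Arrivals capacity ps b b″ → Arrivals capacity (p ∷ ps) b b″
  accept  : ∀ {p ps b b″} → length b ℕ.< capacity →
            Arrivals capacity ps (b ∷ʳ (fromInput , p)) b″ → Arrivals capacity (p ∷ ps) b b″

-- The transmission phase sends take 1 b′ and leaves drop 1 b′.
data Run (capacity : ℕ) : List Tagged → Input → Set where
  end  : ∀ {b} → Run capacity b []
  step : ∀ {b b′ ps σ} → Arrivals capacity ps b b′ →
         Run capacity (drop 1 b′) σ → Run capacity b (ps ∷ σ)

transmitted : ∀ {capacity b σ} → Run capacity b σ → List Tagged
transmitted end                   = []
transmitted (step {b′ = b′} _ r)  = take 1 b′ ++ transmitted r

Schedule : ∀ {capacity} → BufferState capacity → Input → Set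
Schedule {capacity} B σ = Run capacity (map (fromBuffer ,_) (packets B)) σ

v : List Tagged → ℝ
v = foldr (λ q s → value (proj₂ q) +ℝ s) 0ℝ

IsOptimal : ∀ {capacity} {B : BufferState capacity} {σ : Input} → Schedule B σ → Set
IsOptimal {B = B} {σ} S = (S′ : Schedule B σ) → v (transmitted S′) ≤ℝ v (transmitted S)

record OPT {capacity : ℕ} (B : BufferState capacity) (σ : Input) : Set where
  constructor mkOPT
  field
    schedule : Schedule B σ
    optimal  : IsOptimal {B = B} schedule

open OPT public

-- OPT_B(σ) for a given choice O of the optimal schedule OPT(B,σ).
inputPart : ∀ {capacity} {B : BufferState capacity} {σ : Input} → OPT B σ → List Tagged
inputPart O = filterᵇ arrivesInInput (transmitted (schedule O))

{-# OPTIONS --safe #-}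

-- The empty-buffer run copies every accept, reject and preempt decision about
-- input packets, and at each step sends its own head packet.  It is never behind:
-- at any time the input packets in the original buffer are d ++ a, where a is the
-- copy's buffer and d was already sent by the copy.  Hence, by FIFO order, the
-- input packets sent by the original run form a sublist of those sent by the copy,
-- and values are nonnegative.
module Submission where

open import Data.Bool using (T; T?)
open import Data.List using (List; []; _∷_; _++_; length; map; take; drop; filterᵇ)
open import Data.List.Properties using (++-assoc; filter-++; filter-all; length-++-≤ʳ; length-filter; take++drop≡id; ∷-injective)
open import Data.List.Relation.Binary.Sublist.Propositional using (_⊆_; []; _∷ʳ_; _∷_; ⊆-refl; ⊆-trans; ⊆-preorder; minimum)
open import Data.List.Relation.Binary.Sublist.Propositional.Properties using (All-resp-⊆; ++⁺)
import Data.List.Relation.Binary.Sublist.Propositional.Properties as Sublist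
open import Data.List.Relation.Unary.All using (All; []; _∷_)
import Data.List.Relation.Unary.All.Properties as All
open import Data.Nat as ℕ using (ℕ)
import Data.Nat.Properties as ℕ
open import Data.Product using (∃; ∃₂; _×_; _,_)
open import Data.Rational as ℚ using (0ℚ; ½)
import Data.Rational.Properties as ℚ
open import Algebra.Bundles using (CommutativeMonoid)
open import Algebra.Properties.CommutativeSemigroup (CommutativeMonoid.commutativeSemigroup ℚ.+-0-commutativeMonoid) using (interchange)
open import Function using (_∘_)
open import Relation.Binary.PropositionalEquality using (_≡_; refl; sym; trans; cong; subst)
open import Defs

0<½ε : ∀ {ε} → 0ℚ ℚ.< ε → 0ℚ ℚ.< ½ ℚ.* ε
0<½ε {ε} 0<ε = subst (ℚ._< ½ ℚ.* ε) (ℚ.*-zeroʳ ½) (ℚ.*-monoʳ-<-pos ½ 0<ε)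

½ε+½ε≡ε : ∀ ε → ½ ℚ.* ε ℚ.+ ½ ℚ.* ε ≡ ε
½ε+½ε≡ε ε = trans (sym (ℚ.*-distribʳ-+ ε ½ ½)) (ℚ.*-identityˡ ε)

pointwise⇒≤ℝ : ∀ x y → (∀ n → seq x n ℚ.≤ seq y n) → x ≤ℝ y
pointwise⇒≤ℝ x y x≤y ε 0<ε = 0 , λ n _ →
  subst (ℚ._≤ seq y n ℚ.+ ε) (ℚ.+-identityʳ (seq x n)) (ℚ.+-mono-≤ (x≤y n) (ℚ.<⇒≤ 0<ε))

≤ℝ-refl : ∀ x → x ≤ℝ x
≤ℝ-refl x = pointwise⇒≤ℝ x x (λ _ → ℚ.≤-refl)

≤ℝ-trans : ∀ x y z → x ≤ℝ y → y ≤ℝ z → x ≤ℝ z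
≤ℝ-trans x y z x≤y y≤z ε 0<ε
  with M , x≤y+½ε ← x≤y (½ ℚ.* ε) (0<½ε 0<ε)
     | N , y≤z+½ε ← y≤z (½ ℚ.* ε) (0<½ε 0<ε)
  = M ℕ.⊔ N , λ n M⊔N≤n → begin
      seq x n                                  ≤⟨ x≤y+½ε n (ℕ.m⊔n≤o⇒m≤o M N M⊔N≤n) ⟩
      seq y n ℚ.+ ½ ℚ.* ε                      ≤⟨ ℚ.+-monoˡ-≤ (½ ℚ.* ε) (y≤z+½ε n (ℕ.m⊔n≤o⇒n≤o M N M⊔N≤n)) ⟩
      (seq z n ℚ.+ ½ ℚ.* ε) ℚ.+ ½ ℚ.* ε        ≡⟨ ℚ.+-assoc (seq z n) (½ ℚ.* ε) (½ ℚ.* ε) ⟩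
      seq z n ℚ.+ (½ ℚ.* ε ℚ.+ ½ ℚ.* ε)        ≡⟨ cong (seq z n ℚ.+_) (½ε+½ε≡ε ε) ⟩
      seq z n ℚ.+ ε                            ∎
  where open ℚ.≤-Reasoning

+ℝ-mono-≤ℝ : ∀ x y z w → x ≤ℝ y → z ≤ℝ w → x +ℝ z ≤ℝ y +ℝ w
+ℝ-mono-≤ℝ x y z w x≤y z≤w ε 0<ε
  with M , x≤y+½ε ← x≤y (½ ℚ.* ε) (0<½ε 0<ε)
     | N , z≤w+½ε ← z≤w (½ ℚ.* ε) (0<½ε 0<ε)
  = M ℕ.⊔ N , λ n M⊔N≤n → begin
      seq x n ℚ.+ seq z n
        ≤⟨ ℚ.+-mono-≤ (x≤y+½ε n (ℕ.m⊔n≤o⇒m≤o M N M⊔N≤n)) (z≤w+½ε n (ℕ.m⊔n≤o⇒n≤o M N M⊔N≤n)) ⟩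
      (seq y n ℚ.+ ½ ℚ.* ε) ℚ.+ (seq w n ℚ.+ ½ ℚ.* ε)
        ≡⟨ interchange (seq y n) (½ ℚ.* ε) (seq w n) (½ ℚ.* ε) ⟩
      (seq y n ℚ.+ seq w n) ℚ.+ (½ ℚ.* ε ℚ.+ ½ ℚ.* ε)
        ≡⟨ cong ((seq y n ℚ.+ seq w n) ℚ.+_) (½ε+½ε≡ε ε) ⟩
      (seq y n ℚ.+ seq w n) ℚ.+ ε
        ∎
  where open ℚ.≤-Reasoning

x≤ℝ0+x : ∀ x → x ≤ℝ 0ℝ +ℝ x
x≤ℝ0+x x = pointwise⇒≤ℝ x (0ℝ +ℝ x) (λ n → ℚ.≤-reflexive (sym (ℚ.+-identityˡ (seq x n))))

v-mono-⊆ : ∀ {qs rs} → qs ⊆ rs → v qs ≤ℝ v rs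
v-mono-⊆ [] = ≤ℝ-refl 0ℝ
v-mono-⊆ {qs} {_ ∷ rs} ((_ , p) ∷ʳ qs⊆rs) =
  -- The extra packet is worth at least `0ℝ`. Since reals are not quotiented, `v qs` is first
  -- compared with its padded form `0ℝ +ℝ v qs`.
  ≤ℝ-trans (v qs) (0ℝ +ℝ v qs) (value p +ℝ v rs) (x≤ℝ0+x (v qs))
    (+ℝ-mono-≤ℝ 0ℝ (value p) (v qs) (v rs) (nonneg p) (v-mono-⊆ qs⊆rs))
v-mono-⊆ {(_ , p) ∷ qs} {_ ∷ rs} (refl ∷ qs⊆rs) =
  +ℝ-mono-≤ℝ (value p) (value p) (v qs) (v rs) (≤ℝ-refl (value p)) (v-mono-⊆ qs⊆rs)

⊆-++-split : ∀ {A : Set} (ys : List A) {xs zs} → xs ⊆ ys ++ zs →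
             ∃₂ λ ys′ zs′ → xs ≡ ys′ ++ zs′ × ys′ ⊆ ys × zs′ ⊆ zs
⊆-++-split [] {xs} xs⊆zs = [] , xs , refl , [] , xs⊆zs
⊆-++-split (y ∷ ys) (_ ∷ʳ xs⊆) with ⊆-++-split ys xs⊆
... | ys′ , zs′ , eq , ys′⊆ys , zs′⊆zs = ys′ , zs′ , eq , y ∷ʳ ys′⊆ys , zs′⊆zs
⊆-++-split (y ∷ ys) (refl ∷ xs⊆) with ⊆-++-split ys xs⊆
... | ys′ , zs′ , eq , ys′⊆ys , zs′⊆zs = y ∷ ys′ , zs′ , cong (y ∷_) eq , refl ∷ ys′⊆ys , zs′⊆zs

inputs : List Tagged → List Tagged
inputs = filterᵇ arrivesInInput

inputs-++ : ∀ qs rs → inputs (qs ++ rs) ≡ inputs qs ++ inputs rs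
inputs-++ = filter-++ (T? ∘ arrivesInInput)

inputs-mono-⊆ : ∀ {qs rs} → qs ⊆ rs → inputs qs ⊆ inputs rs
inputs-mono-⊆ = Sublist.filter⁺ (T? ∘ arrivesInInput) (T? ∘ arrivesInInput) (λ { refl t → t })

inputs-accept : ∀ b d a p → inputs b ≡ d ++ a →
                inputs (b ++ (fromInput , p) ∷ []) ≡ d ++ a ++ (fromInput , p) ∷ []
inputs-accept b d a p eq = trans (inputs-++ b _) (trans (cong (_++ _) eq) (++-assoc d a _))

-- New packets join the tail, so an acceptance extends only `a`. Only preemption touches `d`, and it
-- can only shrink it.
simulate-arrivals : ∀ {c ps b b′} → Arrivals c ps b b′ → ∀ d a → inputs b ≡ d ++ a →
                    ∃₂ λ d′ a′ → Arrivals c ps a a′ × inputs b′ ≡ d′ ++ a′ × d′ ⊆ d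
simulate-arrivals done d a eq = d , a , done , eq , ⊆-refl
simulate-arrivals (preempt b₁⊆b arr) d a eq
  -- The input packets that survive split into a part of `d` and a part of `a`; the copy preempts
  -- down to the latter.
  with d₁ , a₁ , eq₁ , d₁⊆d , a₁⊆a ← ⊆-++-split d (subst (_ ⊆_) eq (inputs-mono-⊆ b₁⊆b))
  with d′ , a′ , arr′ , eq′ , d′⊆d₁ ← simulate-arrivals arr d₁ a₁ eq₁
  = d′ , a′ , preempt a₁⊆a arr′ , eq′ , ⊆-trans d′⊆d₁ d₁⊆d
simulate-arrivals (reject arr) d a eq
  with d′ , a′ , arr′ , eq′ , d′⊆d ← simulate-arrivals arr d a eq
  = d′ , a′ , reject arr′ , eq′ , d′⊆d
simulate-arrivals {c} (accept {p} {b = b} b<c arr) d a eq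
  with d′ , a′ , arr′ , eq′ , d′⊆d ← simulate-arrivals arr d _ (inputs-accept b d a p eq)
  = d′ , a′ , accept a<c arr′ , eq′ , d′⊆d
  where
    -- The copy has room: its buffer is a suffix of the input packets held by the original, which
    -- had a free slot.
    a<c : length a ℕ.< c
    a<c = begin-strict
      length a           ≤⟨ length-++-≤ʳ a {d} ⟩
      length (d ++ a)    ≡⟨ cong length eq ⟨
      length (inputs b)  ≤⟨ length-filter (T? ∘ arrivesInInput) b ⟩
      length b           <⟨ b<c ⟩
      c                  ∎
      where open ℕ.≤-Reasoning

++-take-drop : ∀ {A : Set} n (xs ys : List A) → xs ++ ys ≡ (xs ++ take n ys) ++ drop n ys
++-take-drop n xs ys = trans (cong (xs ++_) (sym (take++drop≡id n ys))) (sym (++-assoc xs (take n ys) (drop n ys)))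

-- The head of `a` moves to the end of `d`, while the original removes either an old packet or the
-- first entry of `d ++ a`. The last equation is the bookkeeping that the induction over steps
-- chains together.
simulate-transmission : ∀ b d a → inputs b ≡ d ++ a →
                        ∃ λ d′ → inputs (drop 1 b) ≡ d′ ++ drop 1 a ×
                                 inputs (take 1 b) ++ d′ ≡ d ++ take 1 a
simulate-transmission [] [] [] eq = [] , refl , refl
simulate-transmission ((fromBuffer , _) ∷ b) d a eq =
  d ++ take 1 a , trans eq (++-take-drop 1 d a) , refl
-- With no lead left, both runs send the same packet and the lead stays empty.
simulate-transmission ((fromInput , _) ∷ b) [] (_ ∷ a) refl = [] , refl , refl
simulate-transmission ((fromInput , _) ∷ b) (_ ∷ d) a eq with refl , eq′ ← ∷-injective eq =
  d ++ take 1 a , trans eq′ (++-take-drop 1 d a) , refl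

-- The prefix `d` makes the induction go through: the original may still send these packets, which
-- the copy sent before this run began.
simulate-run : ∀ {c b σ} (r : Run c b σ) → ∀ d a → inputs b ≡ d ++ a →
               ∃ λ (r′ : Run c a σ) → inputs (transmitted r) ⊆ d ++ transmitted r′
simulate-run end d a eq = end , minimum _
simulate-run (step {b′ = b′} arr r) d a eq
  with d₁ , a′ , arr′ , eq₁ , d₁⊆d ← simulate-arrivals arr d a eq
  with d₂ , eq₂ , sent ← simulate-transmission b′ d₁ a′ eq₁
  with r′ , r⊆ ← simulate-run r d₂ (drop 1 a′) eq₂
  = step arr′ r′ , (begin
      inputs (take 1 b′ ++ transmitted r)           ≡⟨ inputs-++ (take 1 b′) (transmitted r) ⟩
      inputs (take 1 b′) ++ inputs (transmitted r)  ∼⟨ ++⁺ ⊆-refl r⊆ ⟩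
      inputs (take 1 b′) ++ d₂ ++ transmitted r′    ≡⟨ ++-assoc (inputs (take 1 b′)) d₂ _ ⟨
      (inputs (take 1 b′) ++ d₂) ++ transmitted r′  ≡⟨ cong (_++ transmitted r′) sent ⟩
      (d₁ ++ take 1 a′) ++ transmitted r′           ≡⟨ ++-assoc d₁ (take 1 a′) _ ⟩
      -- Restoring what preemption removed from `d` only enlarges the list.
      d₁ ++ take 1 a′ ++ transmitted r′             ∼⟨ ++⁺ d₁⊆d ⊆-refl ⟩
      d ++ take 1 a′ ++ transmitted r′              ∎)
  where open import Relation.Binary.Reasoning.Preorder (⊆-preorder {A = Tagged})

arrivals-input : ∀ {c ps b b′} → Arrivals c ps b b′ →
                 All (T ∘ arrivesInInput) b → All (T ∘ arrivesInInput) b′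
arrivals-input done             b-in = b-in
arrivals-input (preempt b₁⊆b s) b-in = arrivals-input s (All-resp-⊆ b₁⊆b b-in)
arrivals-input (reject s)       b-in = arrivals-input s b-in
arrivals-input (accept _ s)     b-in = arrivals-input s (All.++⁺ b-in (_ ∷ []))

-- Needed for runs from the empty buffer, where filtering by origin must leave the schedule
-- unchanged.
transmitted-input : ∀ {c b σ} (r : Run c b σ) → All (T ∘ arrivesInInput) b →
                    All (T ∘ arrivesInInput) (transmitted r)
transmitted-input end        b-in = []
transmitted-input (step s r) b-in =
  All.++⁺ (All.take⁺ 1 b′-in) (transmitted-input r (All.drop⁺ 1 b′-in))
  where b′-in = arrivals-input s b-in

inputs-fromBuffer : ∀ ps → inputs (map (fromBuffer ,_) ps) ≡ []
inputs-fromBuffer []       = refl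
inputs-fromBuffer (_ ∷ ps) = inputs-fromBuffer ps

proposition13 : (capacity : ℕ) (B : BufferState capacity) (σ : Input)
    (OPT[∅,σ] : OPT {capacity} ∅ σ) (OPT[B,σ] : OPT B σ) →
    v (inputPart OPT[B,σ]) ≤ℝ v (inputPart OPT[∅,σ])
proposition13 capacity B σ OPT[∅,σ] OPT[B,σ]
  -- Initially nothing from the input is buffered, so the invariant starts with `d` and `a` empty.
  with S , sent⊆S ← simulate-run (schedule OPT[B,σ]) [] [] (inputs-fromBuffer (packets B))
  -- Optimality speaks of everything sent from `∅`, so the filter in `inputPart` is removed first.
  = subst (λ qs → v (inputPart OPT[B,σ]) ≤ℝ v qs)
      (sym (filter-all (T? ∘ arrivesInInput) (transmitted-input (schedule OPT[∅,σ]) [])))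
      (≤ℝ-trans (v (inputPart OPT[B,σ])) (v (transmitted S)) (v (transmitted (schedule OPT[∅,σ])))
        (v-mono-⊆ sent⊆S) (optimal OPT[∅,σ] S))
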